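{- Let $T=T(r,s)$ be a tree with bipartition classes $R$ and $S$ such that $|R|=r\le s=|S|$. (1) If $r=1$, then $\mathrm{ex}(m,n;T(1,s))=(s-1)m$. (2) If $r\ge 2$, let $m$ and $n$ be positive integers satisfying $n\ge s(m-r+2)\binom{m}{r-1}$. Then $$\mathrm{ex}(m,n;T(r,s))\;\le\;(r-1)\,n+C(m,r,s),$$ where $$C(m,r,s)=\binom{m}{r-1}^2(s-1)+m\left\lfloor\frac{m}{r-1}\right\rfloor s+ms(m-r+2)\binom{m}{r-1}.$$
   Context: All graphs are finite, simple and undirected. For a graph $H$ and positive integers $m\le n$, $\mathrm{ex}(m,n;H)$ is the maximum number of edges in an $H$-free bipartite graph $G=(A,B;E)$ with parts $A,B$ of sizes $|A|=m$ and $|B|=n$. Here "$H$-free" means that $G$ contains no (not necessarily induced) subgraph isomorphic to $H$; a copy of $H$ may be placed in $G$ with either orientation with respect to the parts $A,B$. A tree $T$ is bipartite; $T=T(r,s)$ indicates that its two bipartition classes $R,S$ have sizes $r$ and $s$ with $r\le s$.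
   Formalization: Part (1) is proved under the added condition s − 1 ≤ n; without it the equality is false, since for n < s − 1 no star K_{1,s} fits and ex(m,n;T(1,s)) = mn < (s−1)m (e.g. s = 3, m = n = 1). -}

module Defs where

open import Data.Empty using (⊥)
open import Data.Fin using (Fin; zero; suc; inject₁; fromℕ)
open import Data.List using (List; length; filter; cartesianProduct; allFin)
open import Data.Nat using (ℕ; suc; _+_; _*_; _∸_; _^_; _/_; _≤_; NonZero; >-nonZero)
open import Data.Nat.Combinatorics using (_C_)
open import Data.Nat.Properties using (∸-monoˡ-≤)
open import Data.Product using (Σ-syntax; _×_; _,_)
open import Data.Sum using (_⊎_; inj₁; inj₂)
open import Function.Definitions using (Injective)
open import Level using (0ℓ)
open import Relation.Binary using (Rel; REL; Decidable; Symmetric)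
open import Relation.Binary.Construct.Closure.ReflexiveTransitive using (Star)
open import Relation.Binary.PropositionalEquality using (_≡_)
open import Relation.Nullary using (¬_)

record Graph (V : Set) : Set₁ where
  field
    Adj    : Rel V 0ℓ
    sym    : Symmetric Adj
    irrefl : ∀ {v} → ¬ Adj v v

open Graph public using (Adj)

-- The two parts are Fin m and Fin n.  Decidability of the edge relation makes
-- "has an edge" two-valued, as it is classically, so that edges can be counted.
record BipartiteGraph (m n : ℕ) : Set₁ where
  field
    E  : REL (Fin m) (Fin n) 0ℓ
    E? : Decidable E

module _ {m n : ℕ} (G : BipartiteGraph m n) where
  open BipartiteGraph G

  underlying : Graph (Fin m ⊎ Fin n)
  underlying = record { Adj = adj ; sym = λ {u} {v} → adj-sym u v ; irrefl = λ {v} → adj-irrefl v }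
    where
    adj : Rel (Fin m ⊎ Fin n) 0ℓ
    adj (inj₁ a) (inj₂ b) = E a b
    adj (inj₂ b) (inj₁ a) = E a b
    adj (inj₁ _) (inj₁ _) = ⊥
    adj (inj₂ _) (inj₂ _) = ⊥

    adj-sym : ∀ u v → adj u v → adj v u
    adj-sym (inj₁ _) (inj₂ _) e = e
    adj-sym (inj₂ _) (inj₁ _) e = e

    adj-irrefl : ∀ v → ¬ adj v v
    adj-irrefl (inj₁ _) ()
    adj-irrefl (inj₂ _) ()

  edges : List (Fin m × Fin n)
  edges = filter (λ (a , b) → E? a b) (cartesianProduct (allFin m) (allFin n))

-- A subgraph of G isomorphic to H, not necessarily induced.
record Copy {V W : Set} (H : Graph V) (G : Graph W) : Set where
  field
    embed     : V → W
    injective : Injective _≡_ _≡_ embed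
    preserves : ∀ {u v} → Adj H u v → Adj G (embed u) (embed v)

-- Copies of H live in the underlying graph of G, so if H is itself bipartite
-- its classes may be placed in either orientation with respect to the parts.
_-Free_ : ∀ {V m n} → Graph V → BipartiteGraph m n → Set
H -Free G = ¬ Copy H (underlying G)

Connected : ∀ {V} → Graph V → Set
Connected {V} G = V × (∀ u v → Star (Adj G) u v)

-- The cycle c₀ , c₁ , … , c_ℓ , c₀ has ℓ + 1 ≥ 3 distinct vertices.
record Cycle {V : Set} (G : Graph V) : Set where
  field
    ℓ        : ℕ
    2≤ℓ      : 2 ≤ ℓ
    c        : Fin (suc ℓ) → V
    distinct : Injective _≡_ _≡_ c
    step     : ∀ (i : Fin ℓ) → Adj G (c (inject₁ i)) (c (suc i))
    close    : Adj G (c (fromℕ ℓ)) (c zero)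

IsTree : ∀ {V} → Graph V → Set
IsTree G = Connected G × ¬ Cycle G

-- IsEx m n H k says that ex(m,n;H) exists and equals k.
record IsEx {V : Set} (m n : ℕ) (H : Graph V) (k : ℕ) : Set₁ where
  field
    attained : Σ[ G ∈ BipartiteGraph m n ] (H -Free G × length (edges G) ≡ k)
    maximal  : ∀ (G : BipartiteGraph m n) → H -Free G → length (edges G) ≤ k

-- s (m - r + 2) binom(m, r-1).  Truncated subtraction is harmless: if
-- m - r + 2 < 0 then m < r - 1 and the binomial coefficient vanishes.
threshold : (m r s : ℕ) → ℕ
threshold m r s = s * ((m + 2) ∸ r) * (m C (r ∸ 1))

-- The constant C(m,r,s); r ≥ 2 makes the divisor r - 1 nonzero, and _/_ is
-- the floor of the quotient.
constant : (m r s : ℕ) → 2 ≤ r → ℕ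
constant m r s 2≤r =
    (m C (r ∸ 1)) ^ 2 * (s ∸ 1)
  + m * (m / (r ∸ 1)) * s
  + m * s * ((m + 2) ∸ r) * (m C (r ∸ 1))
  where
  instance
    r-1≢0 : NonZero (r ∸ 1)
    r-1≢0 = >-nonZero (∸-monoˡ-≤ 1 2≤r)

{-# OPTIONS --safe #-}

-- A tree with classes of sizes r and s is contained in K_{r,s}, so in a T-free
-- graph at most s·binom(m,r) vertices of B have degree ≥ r: more of them would
-- leave s of them with r common neighbours.  Those vertices contribute at most
-- m edges each and all others at most r − 1, whence
--   e(G) ≤ (r − 1) n + m s binom(m,r) ≤ (r − 1) n + m s (m − r + 2) binom(m,r−1).
-- For r = 1 the circulant graph a ~ a + j mod n with j < s − 1
-- has all degrees on the A side equal to s − 1 and all on the B side at most s − 1.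
module Submission where

import Algebra.Properties.CommutativeSemigroup as CommutativeSemigroupProperties
open import Data.Bool using (T)
open import Data.Bool.Properties using (T?)
open import Data.Empty using (⊥)
open import Data.Fin using (Fin; zero; suc; toℕ; fromℕ<; inject≤; combine; remQuot; join; splitAt; finToFun; funToFin)
open import Data.Fin.Properties
  using (any?; all?; toℕ<n; toℕ-injective; toℕ-fromℕ<; inject≤-injective; injective⇒≤;
         splitAt-join; remQuot-combine; finToFun-funToFin)
  renaming (_≟_ to _≟ᶠ_)
open import Data.Fin.Subset using (Subset)
open import Data.Fin.Subset.Properties using (anySubset?)
open import Data.List using (List; []; _∷_; map; length; filter; cartesianProduct; allFin; lookup; _++_)
open import Data.List.Membership.Propositional using (_∈_)
open import Data.List.Membership.Propositional.Properties using (∈-filter⁺; ∈-lookup; ∈-allFin)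
open import Data.List.Membership.Setoid.Properties using (index-injective)
open import Data.List.Properties
  using (length-++; length-filter; length-tabulate; filter-++; filter-≐; filter-accept; filter-reject;
         cartesianProductWith-zeroʳ)
open import Data.List.Relation.Binary.Sublist.Propositional using (_⊆_; []; _∷_; _∷ʳ_; ⊆-refl; ⊆-trans; minimum)
open import Data.List.Relation.Binary.Sublist.Propositional.Properties using (All-resp-⊆; filter-⊆)
open import Data.List.Relation.Unary.All as All using (All; []; _∷_)
open import Data.List.Relation.Unary.All.Properties using (all-filter)
open import Data.List.Relation.Unary.AllPairs using ([]; _∷_)
open import Data.List.Relation.Unary.Unique.Propositional using (Unique)
open import Data.List.Relation.Unary.Unique.Propositional.Properties using (allFin⁺; filter⁺)
open import Data.Nat using (ℕ; zero; suc; _+_; _*_; _∸_; _^_; _≤_; _<_; _%_; z≤n; s≤s; NonZero; >-nonZero; _≤?_; _<?_; _≟_)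
open import Data.Nat.Combinatorics using (_C_; nCn≡1; nCk≡nC[n∸k]; nCk+nC[k+1]≡[n+1]C[k+1]; k>n⇒nCk≡0)
open import Data.Nat.DivMod using (m%n<n; m<n⇒m%n≡m; %-distribˡ-+; [m+n]%n≡m%n)
open import Data.Nat.Properties hiding (_≟_; _≤?_; _<?_)
open import Data.Nat.Tactic.RingSolver using (solve-∀)
open import Data.Product using (_×_; ∃-syntax; _,_; uncurry)
open import Data.Sum using (_⊎_; inj₁; inj₂; [_,_])
open import Data.Sum.Properties using (inj₁-injective; inj₂-injective; ≡-dec)
open import Data.Vec as Vec using ()
open import Data.Vec.Properties using (lookup∘tabulate)
open import Function using (_∘_; id)
open import Function.Definitions using (Injective)
open import Level using (0ℓ)
open import Relation.Binary using (REL; Decidable; DecidableEquality)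
open import Relation.Binary.Construct.Closure.ReflexiveTransitive using (Star; ε; _◅_)
open import Relation.Binary.PropositionalEquality
  using (_≡_; _≢_; refl; sym; trans; cong; cong₂; subst; subst₂; setoid; module ≡-Reasoning)
open import Relation.Nullary using (Dec; yes; no; ¬_; ¬?; contradiction)
open import Relation.Nullary.Decidable using (map′; _×-dec_; _→-dec_; isYes; toWitness; fromWitness)
import Relation.Unary as U
open import Defs

open CommutativeSemigroupProperties +-commutativeSemigroup using (x∙yz≈y∙xz)

-- Binomial coefficients

nC0≡1 : ∀ n → n C 0 ≡ 1
nC0≡1 n = trans (nCk≡nC[n∸k] {0} {n} z≤n) (nCn≡1 n)

-- Induction on `n` with Pascal's rule. With `k = r ∸ 1` this trades binom(m,r) for (m - r + 2)
-- binom(m,r-1), the form in which the constant is stated.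
nC[1+k]≤[1+n∸k]*nCk : ∀ n k → n C suc k ≤ (suc n ∸ k) * (n C k)
nC[1+k]≤[1+n∸k]*nCk zero    k = ≤-trans (≤-reflexive (k>n⇒nCk≡0 {0} {suc k} (s≤s z≤n))) z≤n
nC[1+k]≤[1+n∸k]*nCk (suc n) zero = begin
  suc n C 1                            ≡⟨ nCk+nC[k+1]≡[n+1]C[k+1] n 0 ⟨
  n C 0 + n C 1                        ≤⟨ +-monoʳ-≤ (n C 0) (nC[1+k]≤[1+n∸k]*nCk n 0) ⟩
  suc (suc n) * (n C 0)                ≡⟨ cong (suc (suc n) *_) (trans (nC0≡1 n) (sym (nC0≡1 (suc n)))) ⟩
  suc (suc n) * (suc n C 0)            ∎
  where open ≤-Reasoning
nC[1+k]≤[1+n∸k]*nCk (suc n) (suc k) with k ≤? n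
-- Here the left side vanishes. The case is split off because `suc n ∸ k` equals `suc (n ∸ k)` only
-- for `k ≤ n`.
... | no k≰n = ≤-trans (≤-reflexive (k>n⇒nCk≡0 (s≤s (m≤n⇒m≤1+n (≰⇒> k≰n))))) z≤n
... | yes k≤n = begin
  suc n C suc (suc k)                  ≡⟨ nCk+nC[k+1]≡[n+1]C[k+1] n (suc k) ⟨
  n C suc k + n C suc (suc k)          ≤⟨ +-monoʳ-≤ (n C suc k) (nC[1+k]≤[1+n∸k]*nCk n (suc k)) ⟩
  suc (n ∸ k) * (n C suc k)            ≡⟨ cong (_* (n C suc k)) (+-∸-assoc 1 k≤n) ⟨
  -- Adding `n C k` inside the product lets Pascal's rule fold the sum back into one coefficient.
  (suc n ∸ k) * (n C suc k)            ≤⟨ *-monoʳ-≤ (suc n ∸ k) (m≤n+m (n C suc k) (n C k)) ⟩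
  (suc n ∸ k) * (n C k + n C suc k)    ≡⟨ cong ((suc n ∸ k) *_) (nCk+nC[k+1]≡[n+1]C[k+1] n k) ⟩
  (suc n ∸ k) * (suc n C suc k)        ∎
  where open ≤-Reasoning

-- Lists without repetitions

Unique-resp-⊆ : ∀ {A : Set} {xs ys : List A} → xs ⊆ ys → Unique ys → Unique xs
Unique-resp-⊆ []         []       = []
Unique-resp-⊆ (_ ∷ʳ p)   (_ ∷ u)  = Unique-resp-⊆ p u
Unique-resp-⊆ (refl ∷ p) (x∉ ∷ u) = All-resp-⊆ p x∉ ∷ Unique-resp-⊆ p u

lookup-injective : ∀ {A : Set} {xs : List A} → Unique xs → Injective _≡_ _≡_ (lookup xs)
lookup-injective {xs = _ ∷ _} _ {zero} {zero} _ = refl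
lookup-injective {xs = _ ∷ xs} (x∉ ∷ _) {zero} {suc j} eq = contradiction eq (All.lookup x∉ (∈-lookup {xs = xs} j))
lookup-injective {xs = _ ∷ xs} (x∉ ∷ _) {suc i} {zero} eq = contradiction (sym eq) (All.lookup x∉ (∈-lookup {xs = xs} i))
lookup-injective {xs = _ ∷ _} (_ ∷ u) {suc i} {suc j} eq = cong suc (lookup-injective u eq)

-- Looking up the first `k` positions gives the map; it turns a list of distinct vertices into one
-- side of an embedding.
unique⇒injection : ∀ {A : Set} {P : A → Set} {k} (xs : List A) → Unique xs → All P xs → k ≤ length xs →
  ∃[ f ] (Injective _≡_ _≡_ f × ∀ (i : Fin k) → P (f i))
unique⇒injection xs u pxs k≤ =
  (λ i → lookup xs (inject≤ i k≤)) ,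
  (λ eq → inject≤-injective k≤ k≤ _ _ (lookup-injective u eq)) ,
  (λ i → All.lookup pxs (∈-lookup {xs = xs} (inject≤ i k≤)))

-- Pigeonhole: sending `i` to the position of `f i` in `xs` is injective.
injection⇒≤length : ∀ {A : Set} {k} {f : Fin k → A} (xs : List A) → Injective _≡_ _≡_ f → (∀ i → f i ∈ xs) → k ≤ length xs
injection⇒≤length xs inj f∈ = injective⇒≤ (λ eq → inj (index-injective (setoid _) (f∈ _) (f∈ _) eq))

-- Double counting

-- Both sides are lists, so that one can induct on vertices and restrict to sublists.
module Counting {A B : Set} {R : REL A B 0ℓ} (R? : Decidable R) where

  outDegree : List B → A → ℕ
  outDegree ys x = length (filter (R? x) ys)

  inDegree : List A → B → ℕ
  inDegree xs y = length (filter (λ x → R? x y) xs)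

  #pairs : List A → List B → ℕ
  #pairs xs ys = length (filter (λ (x , y) → R? x y) (cartesianProduct xs ys))

  length-filter-row : ∀ x ys → length (filter (λ (x , y) → R? x y) (map (x ,_) ys)) ≡ outDegree ys x
  length-filter-row x []       = refl
  length-filter-row x (y ∷ ys) with R? x y
  ... | yes _ = cong suc (length-filter-row x ys)
  ... | no  _ = length-filter-row x ys

  #pairs-∷ˡ : ∀ x xs ys → #pairs (x ∷ xs) ys ≡ outDegree ys x + #pairs xs ys
  #pairs-∷ˡ x xs ys = begin
    #pairs (x ∷ xs) ys
      ≡⟨ cong length (filter-++ P? (map (x ,_) ys) (cartesianProduct xs ys)) ⟩
    length (filter P? (map (x ,_) ys) ++ filter P? (cartesianProduct xs ys))
      ≡⟨ length-++ (filter P? (map (x ,_) ys)) ⟩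
    length (filter P? (map (x ,_) ys)) + #pairs xs ys
      ≡⟨ cong (_+ #pairs xs ys) (length-filter-row x ys) ⟩
    outDegree ys x + #pairs xs ys ∎
    where
    open ≡-Reasoning
    P? : U.Decidable (uncurry R)
    P? (x , y) = R? x y

  -- The product is listed row by row, so a column is split off by induction on the rows, moving its
  -- entry to the front in each.
  #pairs-∷ʳ : ∀ xs y ys → #pairs xs (y ∷ ys) ≡ inDegree xs y + #pairs xs ys
  #pairs-∷ʳ []       y ys = refl
  #pairs-∷ʳ (x ∷ xs) y ys
    rewrite #pairs-∷ˡ x xs (y ∷ ys) | #pairs-∷ˡ x xs ys | #pairs-∷ʳ xs y ys
    with R? x y
  ... | yes _ = cong suc (x∙yz≈y∙xz (outDegree ys x) (inDegree xs y) (#pairs xs ys))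
  ... | no  _ = x∙yz≈y∙xz (outDegree ys x) (inDegree xs y) (#pairs xs ys)

  #pairs-[]ʳ : ∀ xs → #pairs xs [] ≡ 0
  #pairs-[]ʳ xs = cong (length ∘ filter (λ (x , y) → R? x y)) (cartesianProductWith-zeroʳ _,_ xs)

  #pairs-≤ : ∀ d xs ys → (∀ x → outDegree ys x ≤ d) → #pairs xs ys ≤ d * length xs
  #pairs-≤ d []       ys deg≤ = z≤n
  #pairs-≤ d (x ∷ xs) ys deg≤
    rewrite #pairs-∷ˡ x xs ys | *-suc d (length xs) = +-mono-≤ (deg≤ x) (#pairs-≤ d xs ys deg≤)

  #pairs-≥ : ∀ d xs ys → (∀ x → d ≤ outDegree ys x) → d * length xs ≤ #pairs xs ys
  #pairs-≥ d []       ys deg≥ = ≤-reflexive (*-zeroʳ d)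
  #pairs-≥ d (x ∷ xs) ys deg≥
    rewrite #pairs-∷ˡ x xs ys | *-suc d (length xs) = +-mono-≤ (deg≥ x) (#pairs-≥ d xs ys deg≥)

  heavy : ℕ → List A → List B → List B
  heavy q xs = filter (λ y → q <? inDegree xs y)

  -- Summing over `ys`, a light vertex contributes at most `q` and a heavy one at most `length xs`.
  #pairs-≤-heavy : ∀ q xs ys → #pairs xs ys ≤ q * length ys + length xs * length (heavy q xs ys)
  #pairs-≤-heavy q xs [] rewrite #pairs-[]ʳ xs = z≤n
  #pairs-≤-heavy q xs (y ∷ ys) with q <? inDegree xs y
  ... | yes q<deg = begin
    #pairs xs (y ∷ ys)                    ≡⟨ #pairs-∷ʳ xs y ys ⟩
    inDegree xs y + #pairs xs ys          ≤⟨ +-mono-≤ (length-filter _ xs) (#pairs-≤-heavy q xs ys) ⟩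
    -- A heavy vertex is charged an extra `q`, so that the first term runs over all of `ys`.
    a + (q * l + a * h)                   ≤⟨ m≤n+m _ q ⟩
    q + (a + (q * l + a * h))             ≡⟨ regroup q a l h ⟩
    q * suc l + a * suc h                 ≡⟨ cong (λ zs → q * suc l + a * length zs) (filter-accept heavy? q<deg) ⟨
    q * suc l + a * length (heavy q xs (y ∷ ys)) ∎
    where
    open ≤-Reasoning
    heavy? : U.Decidable (λ y → q < inDegree xs y)
    heavy? y = q <? inDegree xs y
    a = length xs
    l = length ys
    h = length (heavy q xs ys)
    regroup : ∀ q a l h → q + (a + (q * l + a * h)) ≡ q * suc l + a * suc h
    regroup = solve-∀
  ... | no q≮deg = begin
    #pairs xs (y ∷ ys)                    ≡⟨ #pairs-∷ʳ xs y ys ⟩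
    inDegree xs y + #pairs xs ys          ≤⟨ +-mono-≤ (≮⇒≥ q≮deg) (#pairs-≤-heavy q xs ys) ⟩
    q + (q * l + a * h)                   ≡⟨ +-assoc q (q * l) (a * h) ⟨
    q + q * l + a * h                     ≡⟨ cong (_+ a * h) (*-suc q l) ⟨
    q * suc l + a * h                     ≡⟨ cong (λ zs → q * suc l + a * length zs) (filter-reject heavy? q≮deg) ⟨
    q * suc l + a * length (heavy q xs (y ∷ ys)) ∎
    where
    open ≤-Reasoning
    heavy? : U.Decidable (λ y → q < inDegree xs y)
    heavy? y = q <? inDegree xs y
    a = length xs
    l = length ys
    h = length (heavy q xs ys)

  length-filter-complement : ∀ {P : B → Set} (P? : U.Decidable P) ys →
    length (filter P? ys) + length (filter (¬? ∘ P?) ys) ≡ length ys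
  length-filter-complement P? []       = refl
  length-filter-complement P? (y ∷ ys) with P? y
  ... | yes _ = cong suc (length-filter-complement P? ys)
  ... | no  _ = trans (+-suc _ _) (cong suc (length-filter-complement P? ys))

  inDegree-adjacent : ∀ {x xs y} → R x y → inDegree (x ∷ xs) y ≡ suc (inDegree xs y)
  inDegree-adjacent {x} {y = y} Rxy with R? x y
  ... | yes _   = refl
  ... | no ¬Rxy = contradiction Rxy ¬Rxy

  inDegree-nonadjacent : ∀ {x xs y} → ¬ R x y → inDegree (x ∷ xs) y ≡ inDegree xs y
  inDegree-nonadjacent {x} {y = y} ¬Rxy with R? x y
  ... | yes Rxy = contradiction Rxy ¬Rxy
  ... | no _    = refl

  -- The sides are sublists, so they inherit distinctness from `xs` and `ys`. Lower bounds on their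
  -- lengths avoid trimming.
  record Biclique (r s : ℕ) (xs : List A) (ys : List B) : Set where
    field
      us       : List A
      vs       : List B
      us⊆      : us ⊆ xs
      vs⊆      : vs ⊆ ys
      r≤       : r ≤ length us
      s≤       : s ≤ length vs
      complete : All (λ u → All (R u) vs) us

  -- Splitting ys according to adjacency with x matches Pascal's rule.
  biclique : ∀ r s xs ys → All (λ y → r ≤ inDegree xs y) ys → s * (length xs C r) < length ys → Biclique r s xs ys
  biclique zero s xs ys _ big = record
    { us = [] ; vs = ys ; us⊆ = minimum xs ; vs⊆ = ⊆-refl ; r≤ = z≤n
    ; s≤ = <⇒≤ (subst (_< length ys) (trans (cong (s *_) (nC0≡1 (length xs))) (*-identityʳ s)) big)
    ; complete = [] }
  -- Over an empty left side every degree is 0, against the degree hypothesis.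
  biclique (suc r) s []       (y ∷ ys) (() ∷ _) big
  biclique (suc r) s (x ∷ xs) ys deg≥ big
    with s * (length xs C r) <? length (filter (R? x) ys)
  ... | yes big₁ = record
    { us = x ∷ us ; vs = vs ; us⊆ = refl ∷ us⊆ ; vs⊆ = ⊆-trans vs⊆ (filter-⊆ (R? x) ys)
    ; r≤ = s≤s r≤ ; s≤ = s≤ ; complete = All-resp-⊆ vs⊆ (all-filter (R? x) ys) ∷ complete }
    where
    open Biclique (biclique r s xs (filter (R? x) ys)
      (All.zipWith (λ (Rxy , deg≥y) → ≤-pred (subst (suc r ≤_) (inDegree-adjacent Rxy) deg≥y))
        (all-filter (R? x) ys , All-resp-⊆ (filter-⊆ (R? x) ys) deg≥))
      big₁)
  -- Too few neighbours of `x`: it is dropped, and its nonneighbours keep their full degree into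
  -- `xs`.
  ... | no ≮ = record
    { us = us ; vs = vs ; us⊆ = x ∷ʳ us⊆ ; vs⊆ = ⊆-trans vs⊆ (filter-⊆ (¬? ∘ R? x) ys)
    ; r≤ = r≤ ; s≤ = s≤ ; complete = complete }
    where
    ys′ = filter (¬? ∘ R? x) ys
    l = length xs
    big₂ : s * (l C suc r) < length ys′
    big₂ = +-cancelˡ-< (s * (l C r)) _ _ (begin-strict
      s * (l C r) + s * (l C suc r)           ≡⟨ *-distribˡ-+ s (l C r) (l C suc r) ⟨
      s * (l C r + l C suc r)                 ≡⟨ cong (s *_) (nCk+nC[k+1]≡[n+1]C[k+1] l r) ⟩
      s * (suc l C suc r)                     <⟨ big ⟩
      length ys                               ≡⟨ length-filter-complement (R? x) ys ⟨
      length (filter (R? x) ys) + length ys′  ≤⟨ +-monoˡ-≤ (length ys′) (≮⇒≥ ≮) ⟩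
      s * (l C r) + length ys′                ∎)
      where open ≤-Reasoning
    open Biclique (biclique (suc r) s xs ys′
      (All.zipWith (λ (¬Rxy , deg≥y) → subst (suc r ≤_) (inDegree-nonadjacent ¬Rxy) deg≥y)
        (all-filter (¬? ∘ R? x) ys , All-resp-⊆ (filter-⊆ (¬? ∘ R? x) ys) deg≥))
      big₂)

open BipartiteGraph

-- Copies of bipartite graphs

module _ {r s m n : ℕ} (H : BipartiteGraph r s) (G : BipartiteGraph m n) where

  -- Every bipartite graph on these two classes is a subgraph of the complete one, so it suffices
  -- that all images across the parts are adjacent.
  straightCopy : (f : Fin r → Fin m) (g : Fin s → Fin n) → Injective _≡_ _≡_ f → Injective _≡_ _≡_ g →
    (∀ i j → E G (f i) (g j)) → Copy (underlying H) (underlying G)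
  straightCopy f g f-inj g-inj adj = record
    { embed     = [ inj₁ ∘ f , inj₂ ∘ g ]
    ; injective = λ { {inj₁ _} {inj₁ _} eq → cong inj₁ (f-inj (inj₁-injective eq))
                    ; {inj₂ _} {inj₂ _} eq → cong inj₂ (g-inj (inj₂-injective eq))
                    ; {inj₁ _} {inj₂ _} ()
                    ; {inj₂ _} {inj₁ _} () }
    ; preserves = λ { {inj₁ i} {inj₂ j} _ → adj i j
                    ; {inj₂ j} {inj₁ i} _ → adj i j
                    ; {inj₁ _} {inj₁ _} ()
                    ; {inj₂ _} {inj₂ _} () } }

  biclique⇒copy : Counting.Biclique (E? G) r s (allFin m) (allFin n) → Copy (underlying H) (underlying G)
  biclique⇒copy K =
    let open Counting.Biclique K
        f , f-inj , f-adj = unique⇒injection us (Unique-resp-⊆ us⊆ (allFin⁺ m)) complete r≤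
        g , g-inj , g∈    = unique⇒injection {P = _∈ vs} vs (Unique-resp-⊆ vs⊆ (allFin⁺ n)) (All.tabulate id) s≤
    in straightCopy f g f-inj g-inj (λ i j → All.lookup (f-adj i) (g∈ j))

-- Upper bound on the number of edges by counting heavy vertices

edges-≤ : ∀ {r s m n} (H : BipartiteGraph r s) (G : BipartiteGraph m n) → 1 ≤ r → underlying H -Free G →
  length (edges G) ≤ (r ∸ 1) * n + m * (s * (m C r))
edges-≤ {suc q} {s} {m} {n} H G _ free = begin
  length (edges G)                                             ≤⟨ #pairs-≤-heavy q (allFin m) (allFin n) ⟩
  q * length (allFin n) + length (allFin m) * length heavies   ≡⟨ cong₂ (λ b a → q * b + a * length heavies)
                                                                  (length-tabulate {n = n} id) (length-tabulate {n = m} id) ⟩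
  q * n + m * length heavies                                   ≤⟨ +-monoʳ-≤ (q * n) (*-monoʳ-≤ m (≮⇒≥ few)) ⟩
  q * n + m * (s * (m C suc q))                                ∎
  where
  open ≤-Reasoning
  open Counting (E? G)
  heavies = heavy q (allFin m) (allFin n)
  few : ¬ s * (m C suc q) < length heavies
  -- The search is run inside `heavies`, where `q < inDegree` unfolds to the required degree bound
  -- `suc q ≤ inDegree`.
  few many = free (biclique⇒copy H G record
    { us = us ; vs = vs ; us⊆ = us⊆ ; vs⊆ = ⊆-trans vs⊆ (filter-⊆ _ (allFin n)) ; r≤ = r≤ ; s≤ = s≤ ; complete = complete })
    where
    open Biclique (biclique (suc q) s (allFin m) heavies (all-filter _ (allFin n))
      (subst (λ l → s * (l C suc q) < length heavies) (sym (length-tabulate {n = m} id)) many))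

m*s*mCr≤constant : ∀ m r s (2≤r : 2 ≤ r) → m * (s * (m C r)) ≤ constant m r s 2≤r
-- `bound` compares with the third summand of `constant`; the sum of the first two is nonnegative.
m*s*mCr≤constant m (suc q) s 2≤r = ≤-trans bound (m≤n+m _ _)
  where
  open ≤-Reasoning
  bound : m * (s * (m C suc q)) ≤ m * s * ((m + 2) ∸ suc q) * (m C q)
  bound = begin
    m * (s * (m C suc q))                      ≡⟨ *-assoc m s _ ⟨
    m * s * (m C suc q)                        ≤⟨ *-monoʳ-≤ (m * s) (nC[1+k]≤[1+n∸k]*nCk m q) ⟩
    m * s * ((suc m ∸ q) * (m C q))            ≡⟨ *-assoc (m * s) _ _ ⟨
    -- `suc m ∸ q` is by computation `(2 + m) ∸ suc q`, so only `2 + m` has to be commuted.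
    m * s * (suc m ∸ q) * (m C q)              ≡⟨ cong (λ k → m * s * (k ∸ suc q) * (m C q)) (+-comm 2 m) ⟩
    m * s * ((m + 2) ∸ suc q) * (m C q)        ∎

-- Finite search for extremal graphs

module _ {m n : ℕ} (G : BipartiteGraph m n) where

  adjacent? : Decidable (Adj (underlying G))
  adjacent? (inj₁ a) (inj₂ b) = E? G a b
  adjacent? (inj₂ b) (inj₁ a) = E? G a b
  adjacent? (inj₁ _) (inj₁ _) = no λ ()
  adjacent? (inj₂ _) (inj₂ _) = no λ ()

_≟⊎_ : ∀ {m n} → DecidableEquality (Fin m ⊎ Fin n)
_≟⊎_ = ≡-dec _≟ᶠ_ _≟ᶠ_

all⊎? : ∀ {m n} {P : Fin m ⊎ Fin n → Set} → U.Decidable P → Dec (∀ v → P v)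
all⊎? P? = map′ (λ (p , q) → [ p , q ]) (λ p → p ∘ inj₁ , p ∘ inj₂) (all? (P? ∘ inj₁) ×-dec all? (P? ∘ inj₂))

-- Vertex maps are coded by the finitely many numbers below `(m + n) ^ (r + s)`, and each map is
-- checked directly.
copy? : ∀ {r s m n} (H : BipartiteGraph r s) (G : BipartiteGraph m n) → Dec (Copy (underlying H) (underlying G))
copy? {r} {s} {m} {n} H G = map′ to from (any? (isCopy? ∘ decode))
  where
  IsCopy : (Fin r ⊎ Fin s → Fin m ⊎ Fin n) → Set
  IsCopy e = (∀ u v → e u ≡ e v → u ≡ v) × (∀ u v → Adj (underlying H) u v → Adj (underlying G) (e u) (e v))

  isCopy? : U.Decidable IsCopy
  isCopy? e =
    all⊎? (λ u → all⊎? (λ v → (e u ≟⊎ e v) →-dec (u ≟⊎ v))) ×-dec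
    all⊎? (λ u → all⊎? (λ v → adjacent? H u v →-dec adjacent? G (e u) (e v)))

  decode : Fin ((m + n) ^ (r + s)) → Fin r ⊎ Fin s → Fin m ⊎ Fin n
  decode i v = splitAt m (finToFun i (join r s v))

  to : ∃[ i ] IsCopy (decode i) → Copy (underlying H) (underlying G)
  to (i , inj , pres) = record { embed = decode i ; injective = inj _ _ ; preserves = λ {u} {v} → pres u v }

  from : Copy (underlying H) (underlying G) → ∃[ i ] IsCopy (decode i)
  from c = i ,
    (λ u v eq → injective (trans (sym (decode-i u)) (trans eq (decode-i v)))) ,
    (λ u v e → subst₂ (Adj (underlying G)) (sym (decode-i u)) (sym (decode-i v)) (preserves e))
    where
    open Copy c
    i = funToFin (λ k → join m n (embed (splitAt r k)))
    -- Pointwise agreement suffices, since `IsCopy` speaks only of values of the map.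
    decode-i : ∀ v → decode i v ≡ embed v
    decode-i v = begin
      splitAt m (finToFun i (join r s v))                   ≡⟨ cong (splitAt m) (finToFun-funToFin _ (join r s v)) ⟩
      splitAt m (join m n (embed (splitAt r (join r s v)))) ≡⟨ splitAt-join m n _ ⟩
      embed (splitAt r (join r s v))                        ≡⟨ cong embed (splitAt-join r s v) ⟩
      embed v                                               ∎
      where open ≡-Reasoning

-- Edge relations are `Set`-valued, so a graph and its coded form agree only up to logical
-- equivalence; edge count and freeness respect this.
module _ {m n : ℕ} {G G′ : BipartiteGraph m n}
  (to : ∀ {a b} → E G a b → E G′ a b) (from : ∀ {a b} → E G′ a b → E G a b) where

  length-edges-cong : length (edges G) ≡ length (edges G′)
  length-edges-cong = cong length (filter-≐ _ _ (to , from) (cartesianProduct (allFin m) (allFin n)))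

  -Free-resp : ∀ {V} {H : Graph V} → H -Free G → H -Free G′
  -Free-resp free c = free record
    { embed = embed ; injective = injective ; preserves = λ {u} {v} e → back (embed u) (embed v) (preserves e) }
    where
    open Copy c
    back : ∀ u v → Adj (underlying G′) u v → Adj (underlying G) u v
    back (inj₁ _) (inj₂ _) = from
    back (inj₂ _) (inj₁ _) = from

-- Bit vectors of length `m * n` make the graphs searchable by `anySubset?`; via `edgeSet` every
-- graph is equivalent to one of these.
subsetGraph : ∀ {m n} → Subset (m * n) → BipartiteGraph m n
subsetGraph S = record { E = λ a b → T (Vec.lookup S (combine a b)) ; E? = λ a b → T? _ }

edgeSet : ∀ {m n} → BipartiteGraph m n → Subset (m * n)
edgeSet {m} {n} G = Vec.tabulate (λ i → isYes (uncurry (E? G) (remQuot n i)))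

lookup-edgeSet : ∀ {m n} (G : BipartiteGraph m n) a b → Vec.lookup (edgeSet G) (combine a b) ≡ isYes (E? G a b)
lookup-edgeSet {n = n} G a b =
  trans (lookup∘tabulate _ (combine a b)) (cong (isYes ∘ uncurry (E? G)) (remQuot-combine {k = n} a b))

-- Search downwards from `N`: whenever `Q` fails at the current bound, the bound drops by one, and
-- the given witness stops this by 0.
largest : ∀ {Q : ℕ → Set} → U.Decidable Q → ∀ N → (∀ k → Q k → k ≤ N) → ∃[ k ] Q k →
  ∃[ k ] (Q k × ∀ j → Q j → j ≤ k)
largest Q? N bound (k , Qk) with Q? N
... | yes QN = N , QN , bound
largest {Q} Q? zero    bound (k , Qk) | no ¬QN = contradiction (subst Q (n≤0⇒n≡0 (bound k Qk)) Qk) ¬QN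
largest Q? (suc N) bound (k , Qk) | no ¬QN =
  largest Q? N (λ j Qj → ≤-pred (≤∧≢⇒< (bound j Qj) (λ { refl → ¬QN Qj }))) (k , Qk)

-- The edge counts of free graphs form a decidable set, bounded by `N` and inhabited through `G₀`,
-- so it has a largest element.
ex-exists : ∀ {r s} m n (H : BipartiteGraph r s) N →
  (∀ (G : BipartiteGraph m n) → underlying H -Free G → length (edges G) ≤ N) →
  ∃[ G ] (_-Free_ {m = m} {n} (underlying H) G) →
  ∃[ k ] (IsEx m n (underlying H) k × k ≤ N)
ex-exists m n H N bound (G₀ , free₀) =
  let k , (S , free , #≡k) , max = largest
        (λ k → anySubset? (λ S → ¬? (copy? H (subsetGraph S)) ×-dec (length (edges (subsetGraph {m} {n} S)) ≟ k)))
        N (λ { _ (S , free , refl) → bound (subsetGraph S) free }) (_ , realised G₀ free₀)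
  in k ,
     record { attained = subsetGraph S , free , #≡k ; maximal = λ G free → max _ (realised G free) } ,
     subst (_≤ N) #≡k (bound (subsetGraph S) free)
  where
  realised : ∀ G → underlying H -Free G →
    ∃[ S ] (underlying H -Free (subsetGraph {m} {n} S) × length (edges (subsetGraph {m} {n} S)) ≡ length (edges G))
  realised G free = edgeSet G , -Free-resp to from free , sym (length-edges-cong {G = G} {subsetGraph (edgeSet G)} to from)
    where
    to : ∀ {a b} → E G a b → E (subsetGraph (edgeSet G)) a b
    to {a} {b} e = subst T (sym (lookup-edgeSet G a b)) (fromWitness {a? = E? G a b} e)
    from : ∀ {a b} → E (subsetGraph (edgeSet G)) a b → E G a b
    from {a} {b} t = toWitness {a? = E? G a b} (subst T (lookup-edgeSet G a b) t)

-- Connectedness and the edgeless graph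

star⇒neighbour : ∀ {V : Set} {R : V → V → Set} {u v} → u ≢ v → Star R u v → ∃[ w ] R u w
star⇒neighbour u≢v ε       = contradiction refl u≢v
star⇒neighbour u≢v (e ◅ _) = _ , e

edgeless : ∀ m n → BipartiteGraph m n
edgeless m n = record { E = λ _ _ → ⊥ ; E? = λ _ _ → no λ () }

edgeless-free : ∀ {r s m n} (H : BipartiteGraph r s) → 1 ≤ r → 1 ≤ s → Connected (underlying H) →
  underlying H -Free edgeless m n
edgeless-free {suc _} {suc _} H _ _ (_ , path) c =
  -- A path between the two classes has a first edge, which a copy would send to an edge of the
  -- edgeless graph.
  let w , e = star⇒neighbour (λ ()) (path (inj₁ zero) (inj₂ zero))
  in noEdge (embed (inj₁ zero)) (embed w) (preserves e)
  where
  open Copy c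
  noEdge : ∀ u v → ¬ Adj (underlying (edgeless _ _)) u v
  noEdge (inj₁ _) (inj₂ _) ()
  noEdge (inj₂ _) (inj₁ _) ()

-- Stars

-- A path from leaf `j` to the centre must start with an edge to the other class, whose only vertex
-- is the centre.
centre-adjacent : ∀ {s} (H : BipartiteGraph 1 s) → Connected (underlying H) → ∀ j → E H zero j
centre-adjacent H (_ , path) j with star⇒neighbour (λ ()) (path (inj₂ j) (inj₁ zero))
... | inj₁ zero , e = e

edges-≤-star : ∀ {s m n} (H : BipartiteGraph 1 s) (G : BipartiteGraph m n) → 1 ≤ s → underlying H -Free G →
  length (edges G) ≤ (s ∸ 1) * m
edges-≤-star {suc d} {m} {n} H G _ free =
  subst (λ l → length (edges G) ≤ d * l) (length-tabulate {n = m} id)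
    (#pairs-≤ d (allFin m) (allFin n) (λ a → ≮⇒≥ (small a)))
  where
  open Counting (E? G)
  small : ∀ a → ¬ d < outDegree (allFin n) a
  small a large =
    let g , g-inj , g-adj = unique⇒injection (filter (E? G a) (allFin n)) (filter⁺ (E? G a) (allFin⁺ n))
                              (all-filter (E? G a) (allFin n)) large
    -- The centre goes to `a` and the leaves to `suc d` of its neighbours.
    in free (straightCopy H G (λ _ → a) g (λ { {zero} {zero} _ → refl }) g-inj (λ _ → g-adj))

-- Shifts modulo `n` and the circulant graph

+-%-cancelʳ : ∀ {x y z n} .{{_ : NonZero n}} → x < n → y < n → z ≤ n → (x + z) % n ≡ (y + z) % n → x ≡ y
+-%-cancelʳ {x} {y} {z} {n} x<n y<n z≤ eq = begin
  x                                       ≡⟨ recover x<n ⟩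
  ((x + z) % n + (n ∸ z) % n) % n         ≡⟨ cong (λ t → (t + (n ∸ z) % n) % n) eq ⟩
  ((y + z) % n + (n ∸ z) % n) % n         ≡⟨ recover y<n ⟨
  y                                       ∎
  where
  open ≡-Reasoning
  -- Shifting further by `n ∸ z` completes a full turn, and a number below `n` is its own residue.
  recover : ∀ {w} → w < n → w ≡ ((w + z) % n + (n ∸ z) % n) % n
  recover {w} w<n = begin
    w                                 ≡⟨ m<n⇒m%n≡m w<n ⟨
    w % n                             ≡⟨ [m+n]%n≡m%n w n ⟨
    (w + n) % n                       ≡⟨ cong (λ t → (w + t) % n) (m+[n∸m]≡n z≤) ⟨
    (w + (z + (n ∸ z))) % n           ≡⟨ cong (_% n) (+-assoc w z (n ∸ z)) ⟨
    (w + z + (n ∸ z)) % n             ≡⟨ %-distribˡ-+ (w + z) (n ∸ z) n ⟩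
    ((w + z) % n + (n ∸ z) % n) % n   ∎

module Circulant (d m n : ℕ) (1≤n : 1 ≤ n) (m≤n : m ≤ n) (d≤n : d ≤ n) where

  instance
    n≢0 : NonZero n
    n≢0 = >-nonZero 1≤n

  -- An edge carries its offset `j`, which later serves as its colour.
  circulant : BipartiteGraph m n
  circulant = record
    { E  = λ a b → ∃[ j ] toℕ b ≡ (toℕ a + toℕ {d} j) % n
    ; E? = λ a b → any? (λ j → toℕ b ≟ (toℕ a + toℕ j) % n) }

  A<n : (a : Fin m) → toℕ a < n
  A<n a = <-≤-trans (toℕ<n a) m≤n

  J<n : (j : Fin d) → toℕ j < n
  J<n j = <-≤-trans (toℕ<n j) d≤n

  J-injective : ∀ (a : Fin m) {i j : Fin d} → (toℕ a + toℕ i) % n ≡ (toℕ a + toℕ j) % n → i ≡ j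
  J-injective a {i} {j} eq = toℕ-injective (+-%-cancelʳ (J<n i) (J<n j) (<⇒≤ (A<n a))
    (subst₂ (λ u v → u % n ≡ v % n) (+-comm (toℕ a) (toℕ i)) (+-comm (toℕ a) (toℕ j)) eq))

  A-injective : ∀ (j : Fin d) {a a′ : Fin m} → (toℕ a + toℕ j) % n ≡ (toℕ a′ + toℕ j) % n → a ≡ a′
  A-injective j {a} {a′} eq = toℕ-injective (+-%-cancelʳ (A<n a) (A<n a′) (<⇒≤ (J<n j)) eq)

  edges-≥ : d * m ≤ length (edges circulant)
  edges-≥ = subst (λ l → d * l ≤ length (edges circulant)) (length-tabulate {n = m} id)
    (#pairs-≥ d (allFin m) (allFin n) λ a →
      -- The `d` offsets lead from `a` to distinct neighbours because `d ≤ n`.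
      injection⇒≤length (filter (E? circulant a) (allFin n))
        (λ {i} {j} eq → J-injective a (trans (sym (toℕ-neighbour a i)) (trans (cong toℕ eq) (toℕ-neighbour a j))))
        (λ j → ∈-filter⁺ (E? circulant a) (∈-allFin (neighbour a j)) (j , toℕ-neighbour a j)))
    where
    open Counting (E? circulant)
    neighbour : Fin m → Fin d → Fin n
    neighbour a j = fromℕ< (m%n<n (toℕ a + toℕ j) n)
    toℕ-neighbour : ∀ a j → toℕ (neighbour a j) ≡ (toℕ a + toℕ j) % n
    toℕ-neighbour a j = toℕ-fromℕ< _

  label : ∀ u v → Adj (underlying circulant) u v → Fin d
  label (inj₁ _) (inj₂ _) (j , _) = j
  label (inj₂ _) (inj₁ _) (j , _) = j

  -- The offsets form a proper edge colouring: offset and one end determine the other end, by the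
  -- defining equation or by cancelling the shift.
  label-injective : ∀ u {v w} (e : Adj (underlying circulant) u v) (f : Adj (underlying circulant) u w) →
    label u v e ≡ label u w f → v ≡ w
  label-injective (inj₁ a) {inj₂ b} {inj₂ b′} (j , p) (_ , q) refl = cong inj₂ (toℕ-injective (trans p (sym q)))
  label-injective (inj₂ b) {inj₁ a} {inj₁ a′} (j , p) (_ , q) refl = cong inj₁ (A-injective j (trans (sym p) q))

  -- The `s` edges at the image of the centre have distinct colours among `d`. The colouring is
  -- proper on both sides, so either orientation is covered.
  star-free : ∀ {s} (H : BipartiteGraph 1 s) → Connected (underlying H) → d < s → underlying H -Free circulant
  star-free H conn d<s c = <⇒≱ d<s (injective⇒≤ leafLabel-injective)
    where
    open Copy c
    spoke : ∀ l → Adj (underlying circulant) (embed (inj₁ zero)) (embed (inj₂ l))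
    spoke l = preserves {inj₁ zero} {inj₂ l} (centre-adjacent H conn l)
    leafLabel : Fin _ → Fin d
    leafLabel l = label (embed (inj₁ zero)) (embed (inj₂ l)) (spoke l)
    leafLabel-injective : Injective _≡_ _≡_ leafLabel
    leafLabel-injective {l} {l′} eq =
      inj₂-injective (injective (label-injective (embed (inj₁ zero)) (spoke l) (spoke l′) eq))

theorem1p2 : ∀ (r s : ℕ) (T : BipartiteGraph r s) → IsTree (underlying T) → r ≤ s →
    (r ≡ 1 → ∀ (m n : ℕ) → 1 ≤ m → m ≤ n → s ∸ 1 ≤ n →
    IsEx m n (underlying T) ((s ∸ 1) * m))
    ×
    ((2≤r : 2 ≤ r) → ∀ (m n : ℕ) → 1 ≤ m → m ≤ n → threshold m r s ≤ n →
    ∃[ k ] (IsEx m n (underlying T) k × k ≤ (r ∸ 1) * n + constant m r s 2≤r))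
theorem1p2 r s T (conn , _) r≤s = star , general
  where
  star : r ≡ 1 → ∀ (m n : ℕ) → 1 ≤ m → m ≤ n → s ∸ 1 ≤ n → IsEx m n (underlying T) ((s ∸ 1) * m)
  star refl m n 1≤m m≤n s-1≤n = record
    { attained = circulant , free , ≤-antisym (edges-≤-star T circulant r≤s free) edges-≥
    ; maximal  = λ G → edges-≤-star T G r≤s }
    where
    open Circulant (s ∸ 1) m n (≤-trans 1≤m m≤n) m≤n s-1≤n
    -- With `r = 1`, `r≤s` says `1 ≤ s`, whence `suc (s ∸ 1) ≡ s`.
    free = star-free T conn (≤-reflexive (m+[n∸m]≡n r≤s))

  general : (2≤r : 2 ≤ r) → ∀ (m n : ℕ) → 1 ≤ m → m ≤ n → threshold m r s ≤ n →
    ∃[ k ] (IsEx m n (underlying T) k × k ≤ (r ∸ 1) * n + constant m r s 2≤r)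
  general 2≤r m n _ _ _ = ex-exists m n T _
    (λ G free → ≤-trans (edges-≤ T G 1≤r free) (+-monoʳ-≤ ((r ∸ 1) * n) (m*s*mCr≤constant m r s 2≤r)))
    -- The edgeless graph starts the search for the maximum.
    (edgeless m n , edgeless-free T 1≤r (≤-trans 1≤r r≤s) conn)
    where
    1≤r = ≤-trans (s≤s z≤n) 2≤r
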